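{- If $\Gamma\cup\Delta\subseteq\forall_1$ and there exists an $\alpha$-flow from $\Gamma$ to $\Delta$ (i.e. from $\bigwedge\Gamma$ to $\bigvee\Delta$), then $\mathrm{TI}(\forall_1,\prec)\vdash\Gamma\Rightarrow\Delta$.
   Context: **Setting.** $\mathrm{PV}$ is Cook's theory of polynomial time functions, as a universal first-order theory in the language $\mathcal{L}_{\mathrm{PV}}$. $\alpha$ is an ordinal with a $\mathrm{PV}$-representation $\prec$ of its order and of its ordinal arithmetic: $\prec$ is a quantifier-free relation of $\mathcal{L}_{\mathrm{PV}}$ of order type $\alpha$, and there are $\mathcal{L}_{\mathrm{PV}}$-terms $+,\cdot,-,\lfloor\frac{\cdot}{\cdot}\rfloor$ and constants $0,1$ for ordinal arithmetic such that $\mathrm{PV}$ proves the axioms of discrete ordered semirings for them, except commutativity of addition, together with the axioms that $\prec$ is preserved under left addition and under left multiplication by a non-zero element. Greek letters $\beta,\gamma,\delta$ range over (codes of) ordinals; $\preceq$, $\gamma+1$, etc. refer to this representation. $\forall_1$ is the class of universal formulas of $\mathcal{L}_{\mathrm{PV}}$ (conjunctions and disjunctions of such formulas being identified with equivalent universal formulas). **The system $\mathrm{TI}(\forall_1,\prec)$.** The usual first-order sequent calculus in $\mathcal{L}_{\mathrm{PV}}$ plus the axioms of $\mathrm{PV}$ and the induction rule: from $\Gamma,\forall\gamma\prec\beta\,A(\gamma)\Rightarrow\Delta,A(\beta)$ infer $\Gamma\Rightarrow\Delta,A(\delta)$, for every $A\in\forall_1$ ($\beta$ an eigenvariable, $\delta$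 a term). **$\alpha$-flow.** For $A(\vec x),B(\vec x)\in\forall_1$, an $\alpha$-flow from $A$ to $B$ (written $A\rhd B$) is a pair $(H,\beta)$, with $H(\delta,\vec x)\in\forall_1$ a formula and $\beta$ a term for an ordinal, such that: (i) $\mathrm{PV}\vdash A(\vec x)\to\forall\gamma\prec1\;H(\gamma,\vec x)$; (ii) $\mathrm{PV}\vdash\forall\gamma\prec\beta\,[\forall\delta\prec\gamma\,H(\delta,\vec x)\to\forall\delta\prec\gamma+1\,H(\delta,\vec x)]$; (iii) $\mathrm{PV}\vdash(\forall\gamma\prec\beta\,H(\gamma,\vec x))\to B(\vec x)$. -}

module Defs where

open import Data.Empty using (⊥)
open import Data.Fin.Base using (Fin; zero; suc; _↑ʳ_)
open import Data.Fin.Patterns using (0F; 1F; 2F)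
open import Data.Fin.Substitution using (Sub; Simple)
open import Data.List.Base using (List; []; _∷_; [_]; foldr; map)
open import Data.List.Relation.Binary.Subset.Propositional using (_⊆_)
open import Data.Nat.Base using (ℕ; zero; suc; _+_)
open import Data.Nat.Binary.Base using (ℕᵇ; zero; 2[1+_]; 1+[2_])
open import Data.Product.Base using (Σ-syntax; ∃; _×_; proj₁)
open import Data.Product.Relation.Binary.Lex.Strict using (×-Lex)
import Data.Product.Relation.Binary.Pointwise.NonDependent as ×
open import Data.Sum.Base using (_⊎_)
open import Data.Sum.Relation.Binary.LeftOrder using (_⊎-<_)
import Data.Sum.Relation.Binary.Pointwise as ⊎
open import Data.Vec.Base as Vec using (Vec; []; _∷_; lookup; tabulate)
open import Data.Vec.Relation.Binary.Pointwise.Inductive using (Pointwise)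
open import Function.Base using (_on_)
open import Induction.WellFounded using (WellFounded)
open import Level using (0ℓ)
open import Relation.Binary.Bundles using (StrictTotalOrder)
open import Relation.Binary.Bundles.Raw using (RawRelation)
open import Relation.Binary.Morphism.Structures using (IsOrderIsomorphism)
open import Relation.Binary.PropositionalEquality.Core using (_≡_)

------------------------------------------------------------------------
-- Terms over a signature of function symbols graded by arity

data Term (F : ℕ → Set) (n : ℕ) : Set where
  var : Fin n → Term F n
  app : ∀ {k} → F k → Vec (Term F n) k → Term F n

infixl 8 _/_

mutual
  _/_ : ∀ {F m n} → Term F m → Vec (Term F n) m → Term F n
  var x    / ρ = lookup ρ x
  app f ts / ρ = app f (ts /* ρ)

  _/*_ : ∀ {F k m n} → Vec (Term F m) k → Vec (Term F n) m → Vec (Term F n) k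
  []       /* ρ = []
  (t ∷ ts) /* ρ = t / ρ ∷ ts /* ρ

-- The variables k, …, k + n - 1.  This is wk⋆ k below, in a form whose
-- use in the types of constructors passes the positivity checker.
vars : ∀ {F} k {n} → Vec (Term F (k + n)) n
vars k = tabulate (λ i → var (k ↑ʳ i))

-- Terms contain no binders, so weakening is a substitution.
simple : ∀ {F} → Simple (Term F)
simple = record { var = var ; weaken = _/ vars 1 }

open module TermSubstitution {F} = Simple (simple {F}) public
  using (_↑; id; wk; wk⋆; sub)

------------------------------------------------------------------------
-- Cook's PV: function symbols and derivable equations

-- As in Cook's original system, numbers are in dyadic notation, with
-- the bijective successors sᵢ(x) = 2x + i for i = 1, 2.  LESS(x , y)
-- deletes the last |y| digits of x, so it vanishes iff |x| ≤ |y|.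
-- A symbol f introduced by REC, with
--   f(0,ȳ) = g(ȳ),   f(sᵢ(x),ȳ) = hᵢ(x,f(x,ȳ),ȳ),
-- carries derivations of |hᵢ(x,z,ȳ)| ≤ |z| + |kᵢ(x,ȳ)|; hence symbols
-- and derivable equations are generated simultaneously.

infix 4 _≈_

data Fun : ℕ → Set
data _≈_ : ∀ {n} → Term Fun n → Term Fun n → Set

data Fun where
  O              : Fun 0
  S₁ S₂ TR       : Fun 1
  CAT SMASH LESS : Fun 2
  DEF : ∀ {n} → Term Fun n → Fun n
  REC : ∀ {n} (g : Fun n) (h₁ h₂ : Fun (2 + n)) (k₁ k₂ : Fun (1 + n)) →
        app LESS (app h₁ (vars 0) ∷ app CAT (var 1F ∷ app k₁ (var 0F ∷ vars 2) ∷ []) ∷ [])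
          ≈ app O [] →
        app LESS (app h₂ (vars 0) ∷ app CAT (var 1F ∷ app k₂ (var 0F ∷ vars 2) ∷ []) ∷ [])
          ≈ app O [] →
        Fun (1 + n)

data _≈_ where
  ≈-refl  : ∀ {n} {t : Term Fun n} → t ≈ t
  ≈-sym   : ∀ {n} {t u : Term Fun n} → t ≈ u → u ≈ t
  ≈-trans : ∀ {n} {t u v : Term Fun n} → t ≈ u → u ≈ v → t ≈ v
  ≈-cong  : ∀ {n k} (f : Fun k) {ts us : Vec (Term Fun n) k} →
            Pointwise _≈_ ts us → app f ts ≈ app f us
  ≈-subst : ∀ {m n} {t u : Term Fun m} → t ≈ u → (σ : Sub (Term Fun) m n) →
            t / σ ≈ u / σ

  TR-O  : ∀ {n} → app TR (app O [] ∷ []) ≈ app {n = n} O []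
  TR-S₁ : ∀ {n} {x : Term Fun n} → app TR (app S₁ (x ∷ []) ∷ []) ≈ x
  TR-S₂ : ∀ {n} {x : Term Fun n} → app TR (app S₂ (x ∷ []) ∷ []) ≈ x

  CAT-O  : ∀ {n} {x : Term Fun n} → app CAT (x ∷ app O [] ∷ []) ≈ x
  CAT-S₁ : ∀ {n} {x y : Term Fun n} →
           app CAT (x ∷ app S₁ (y ∷ []) ∷ []) ≈ app S₁ (app CAT (x ∷ y ∷ []) ∷ [])
  CAT-S₂ : ∀ {n} {x y : Term Fun n} →
           app CAT (x ∷ app S₂ (y ∷ []) ∷ []) ≈ app S₂ (app CAT (x ∷ y ∷ []) ∷ [])

  SMASH-O  : ∀ {n} {x : Term Fun n} → app SMASH (x ∷ app O [] ∷ []) ≈ app O []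
  SMASH-S₁ : ∀ {n} {x y : Term Fun n} →
             app SMASH (x ∷ app S₁ (y ∷ []) ∷ []) ≈
             app CAT (x ∷ app SMASH (x ∷ y ∷ []) ∷ [])
  SMASH-S₂ : ∀ {n} {x y : Term Fun n} →
             app SMASH (x ∷ app S₂ (y ∷ []) ∷ []) ≈
             app CAT (x ∷ app SMASH (x ∷ y ∷ []) ∷ [])

  LESS-O  : ∀ {n} {x : Term Fun n} → app LESS (x ∷ app O [] ∷ []) ≈ x
  LESS-S₁ : ∀ {n} {x y : Term Fun n} →
            app LESS (x ∷ app S₁ (y ∷ []) ∷ []) ≈ app TR (app LESS (x ∷ y ∷ []) ∷ [])
  LESS-S₂ : ∀ {n} {x y : Term Fun n} →
            app LESS (x ∷ app S₂ (y ∷ []) ∷ []) ≈ app TR (app LESS (x ∷ y ∷ []) ∷ [])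

  DEF-≈ : ∀ {m n} {t : Term Fun m} {us : Vec (Term Fun n) m} →
          app (DEF t) us ≈ t / us

  REC-O  : ∀ {m n} {g : Fun m} {h₁ h₂ k₁ k₂ p₁ p₂} {ys : Vec (Term Fun n) m} →
           app (REC g h₁ h₂ k₁ k₂ p₁ p₂) (app O [] ∷ ys) ≈ app g ys
  REC-S₁ : ∀ {m n} {g : Fun m} {h₁ h₂ k₁ k₂ p₁ p₂} {x} {ys : Vec (Term Fun n) m} →
           app (REC g h₁ h₂ k₁ k₂ p₁ p₂) (app S₁ (x ∷ []) ∷ ys) ≈
           app h₁ (x ∷ app (REC g h₁ h₂ k₁ k₂ p₁ p₂) (x ∷ ys) ∷ ys)
  REC-S₂ : ∀ {m n} {g : Fun m} {h₁ h₂ k₁ k₂ p₁ p₂} {x} {ys : Vec (Term Fun n) m} →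
           app (REC g h₁ h₂ k₁ k₂ p₁ p₂) (app S₂ (x ∷ []) ∷ ys) ≈
           app h₂ (x ∷ app (REC g h₁ h₂ k₁ k₂ p₁ p₂) (x ∷ ys) ∷ ys)

  -- Cook's induction rule: two functions satisfying the same recursion
  -- on notation are equal.
  ≈-ind : ∀ {n} (f f′ : Fun (1 + n)) (g : Fun n) (h₁ h₂ : Fun (2 + n)) →
          app f  (app O [] ∷ vars 0) ≈ app g (vars 0) →
          app f′ (app O [] ∷ vars 0) ≈ app g (vars 0) →
          app f  (app S₁ (var 0F ∷ []) ∷ vars 1) ≈ app h₁ (var 0F ∷ app f (vars 0) ∷ vars 1) →
          app f′ (app S₁ (var 0F ∷ []) ∷ vars 1) ≈ app h₁ (var 0F ∷ app f′ (vars 0) ∷ vars 1) →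
          app f  (app S₂ (var 0F ∷ []) ∷ vars 1) ≈ app h₂ (var 0F ∷ app f (vars 0) ∷ vars 1) →
          app f′ (app S₂ (var 0F ∷ []) ∷ vars 1) ≈ app h₂ (var 0F ∷ app f′ (vars 0) ∷ vars 1) →
          app f (vars 0) ≈ app f′ (vars 0)

------------------------------------------------------------------------
-- First-order formulas

infix  9 _≐_
infixr 8 _∧_
infixr 7 _∨_
infixr 6 _⇒_

-- A formula with free variables among n de Bruijn indices.
data Formula (n : ℕ) : Set where
  ⊥′          : Formula n
  _≐_         : Term Fun n → Term Fun n → Formula n
  _∧_ _∨_ _⇒_ : Formula n → Formula n → Formula n
  ∀′ ∃′       : Formula (suc n) → Formula n

infix 10 ¬′_

¬′_ : ∀ {n} → Formula n → Formula n
¬′ A = A ⇒ ⊥′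

⋀ ⋁ : ∀ {n} → List (Formula n) → Formula n
⋀ = foldr _∧_ (¬′ ⊥′)
⋁ = foldr _∨_ ⊥′

infixl 11 _/ᶠ_

_/ᶠ_ : ∀ {m n} → Formula m → Sub (Term Fun) m n → Formula n
⊥′      /ᶠ ρ = ⊥′
(s ≐ t) /ᶠ ρ = (s / ρ) ≐ (t / ρ)
(A ∧ B) /ᶠ ρ = (A /ᶠ ρ) ∧ (B /ᶠ ρ)
(A ∨ B) /ᶠ ρ = (A /ᶠ ρ) ∨ (B /ᶠ ρ)
(A ⇒ B) /ᶠ ρ = (A /ᶠ ρ) ⇒ (B /ᶠ ρ)
∀′ A    /ᶠ ρ = ∀′ (A /ᶠ (ρ ↑))
∃′ A    /ᶠ ρ = ∃′ (A /ᶠ (ρ ↑))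

weaken : ∀ {n} → Formula n → Formula (suc n)
weaken A = A /ᶠ wk

data QuantifierFree {n : ℕ} : Formula n → Set where
  ⊥′  : QuantifierFree ⊥′
  _≐_ : ∀ s t → QuantifierFree (s ≐ t)
  _∧_ : ∀ {A B} → QuantifierFree A → QuantifierFree B → QuantifierFree (A ∧ B)
  _∨_ : ∀ {A B} → QuantifierFree A → QuantifierFree B → QuantifierFree (A ∨ B)
  _⇒_ : ∀ {A B} → QuantifierFree A → QuantifierFree B → QuantifierFree (A ⇒ B)

-- The class ∀₁.  Formulas that become universal by moving quantifiers
-- out of conjunctions, disjunctions and consequents of open formulas
-- (A ⇒ B being ¬ A ∨ B) count as universal.
data Universal {n : ℕ} : Formula n → Set where
  open′ : ∀ {A} → QuantifierFree A → Universal A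
  _∧_   : ∀ {A B} → Universal A → Universal B → Universal (A ∧ B)
  _∨_   : ∀ {A B} → Universal A → Universal B → Universal (A ∨ B)
  _⇒_   : ∀ {A B} → QuantifierFree A → Universal B → Universal (A ⇒ B)
  ∀′    : ∀ {A} → Universal A → Universal (∀′ A)

------------------------------------------------------------------------
-- Universal theory PV

-- Free variables are understood as universally quantified.  The last
-- three schemes make every open formula A equivalent to an equation
-- χ(x̄) = s₁(0) for a function symbol χ, so that open induction
-- (equivalently its universal Skolemised form) is inherited from ≈-ind.
data PVAxiom {n : ℕ} : Formula n → Set where
  equation : ∀ {s t} → s ≈ t → PVAxiom (s ≐ t)
  S₁≢O     : ∀ t → PVAxiom (¬′ (app S₁ (t ∷ []) ≐ app O []))
  S₂≢O     : ∀ t → PVAxiom (¬′ (app S₂ (t ∷ []) ≐ app O []))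
  cases    : ∀ t → PVAxiom (t ≐ app O [] ∨
                            t ≐ app S₁ (app TR (t ∷ []) ∷ []) ∨
                            t ≐ app S₂ (app TR (t ∷ []) ∷ []))

------------------------------------------------------------------------
-- Sequent calculus with equality and the axioms of PV, extended by a
-- further set of one-premise rules

infix 3 _⟹_

data Sequent (n : ℕ) : Set where
  _⟹_ : List (Formula n) → List (Formula n) → Sequent n

Rule : Set₁
Rule = ∀ {m n} → Sequent m → Sequent n → Set

infix 2 _⊢_

data _⊢_ (R : Rule) : ∀ {n} → Sequent n → Set where
  ax : ∀ {n} (A : Formula n) → R ⊢ [ A ] ⟹ [ A ]

  -- Weakening, contraction and exchange.
  structural : ∀ {n} {Γ Γ′ Δ Δ′ : List (Formula n)} →
               Γ ⊆ Γ′ → Δ ⊆ Δ′ → R ⊢ Γ ⟹ Δ → R ⊢ Γ′ ⟹ Δ′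

  cut : ∀ {n Γ Δ} (A : Formula n) →
        R ⊢ Γ ⟹ A ∷ Δ → R ⊢ A ∷ Γ ⟹ Δ → R ⊢ Γ ⟹ Δ

  ⊥L  : ∀ {n} → R ⊢ [ ⊥′ {n} ] ⟹ []
  ∧L  : ∀ {n Γ Δ} {A B : Formula n} →
        R ⊢ A ∷ B ∷ Γ ⟹ Δ → R ⊢ A ∧ B ∷ Γ ⟹ Δ
  ∧R  : ∀ {n Γ Δ} {A B : Formula n} →
        R ⊢ Γ ⟹ A ∷ Δ → R ⊢ Γ ⟹ B ∷ Δ → R ⊢ Γ ⟹ A ∧ B ∷ Δ
  ∨L  : ∀ {n Γ Δ} {A B : Formula n} →
        R ⊢ A ∷ Γ ⟹ Δ → R ⊢ B ∷ Γ ⟹ Δ → R ⊢ A ∨ B ∷ Γ ⟹ Δ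
  ∨R  : ∀ {n Γ Δ} {A B : Formula n} →
        R ⊢ Γ ⟹ A ∷ B ∷ Δ → R ⊢ Γ ⟹ A ∨ B ∷ Δ
  ⇒L  : ∀ {n Γ Δ} {A B : Formula n} →
        R ⊢ Γ ⟹ A ∷ Δ → R ⊢ B ∷ Γ ⟹ Δ → R ⊢ A ⇒ B ∷ Γ ⟹ Δ
  ⇒R  : ∀ {n Γ Δ} {A B : Formula n} →
        R ⊢ A ∷ Γ ⟹ B ∷ Δ → R ⊢ Γ ⟹ A ⇒ B ∷ Δ
  ∀L  : ∀ {n Γ Δ} {A : Formula (suc n)} (t : Term Fun n) →
        R ⊢ A /ᶠ sub t ∷ Γ ⟹ Δ → R ⊢ ∀′ A ∷ Γ ⟹ Δ
  ∀R  : ∀ {n Γ Δ} {A : Formula (suc n)} →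
        R ⊢ map weaken Γ ⟹ A ∷ map weaken Δ → R ⊢ Γ ⟹ ∀′ A ∷ Δ
  ∃L  : ∀ {n Γ Δ} {A : Formula (suc n)} →
        R ⊢ A ∷ map weaken Γ ⟹ map weaken Δ → R ⊢ ∃′ A ∷ Γ ⟹ Δ
  ∃R  : ∀ {n Γ Δ} {A : Formula (suc n)} (t : Term Fun n) →
        R ⊢ Γ ⟹ A /ᶠ sub t ∷ Δ → R ⊢ Γ ⟹ ∃′ A ∷ Δ

  ≐-refl  : ∀ {n} (t : Term Fun n) → R ⊢ [] ⟹ [ t ≐ t ]
  ≐-subst : ∀ {n} (A : Formula (suc n)) (s t : Term Fun n) →
            R ⊢ s ≐ t ∷ A /ᶠ sub s ∷ [] ⟹ [ A /ᶠ sub t ]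

  pv   : ∀ {n} {A : Formula n} → PVAxiom A → R ⊢ [] ⟹ [ A ]
  rule : ∀ {m n} {P : Sequent m} {C : Sequent n} → R P C → R ⊢ P → R ⊢ C

noRule : Rule
noRule _ _ = ⊥

infix 2 PV⊢_

PV⊢_ : ∀ {n} → Formula n → Set
PV⊢ A = noRule ⊢ [] ⟹ [ A ]

------------------------------------------------------------------------
-- Order formulas and transfinite induction

module Order (prec : Formula 2) where

  infix 9 _≺_ _≼_

  _≺_ _≼_ : ∀ {n} → Term Fun n → Term Fun n → Formula n
  s ≺ t = prec /ᶠ (s ∷ t ∷ [])
  s ≼ t = s ≺ t ∨ s ≐ t

  -- ∀ γ ≺ t. A(γ), where γ is variable 0 of A and does not occur in t.
  ∀≺ : ∀ {n} → Term Fun n → Formula (suc n) → Formula n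
  ∀≺ t A = ∀′ (var 0F ≺ (t / wk) ⇒ A)

-- The system TI(C , ≺).  In the premise, variable 0 is the eigenvariable
-- β; the substitution wk ↑ turns A(β) into A(γ) in the scope of γ, β.
data TI (C : ∀ {n} → Formula n → Set) (prec : Formula 2) : Rule where
  induction : ∀ {n Γ Δ} {A : Formula (suc n)} → C A → (δ : Term Fun n) →
              TI C prec (Order.∀≺ prec (var 0F) (A /ᶠ (wk ↑)) ∷ map weaken Γ
                           ⟹ A ∷ map weaken Δ)
                        (Γ ⟹ A /ᶠ sub δ ∷ Δ)

------------------------------------------------------------------------
-- The standard model

-- ℕᵇ is dyadic notation: 1+[2 x ] is s₁(x) and 2[1+ x ] is s₂(x).

foldᵇ : ∀ {A : Set} → A → (ℕᵇ → A → A) → (ℕᵇ → A → A) → ℕᵇ → A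
foldᵇ z s₁ s₂ zero     = z
foldᵇ z s₁ s₂ 1+[2 x ] = s₁ x (foldᵇ z s₁ s₂ x)
foldᵇ z s₁ s₂ 2[1+ x ] = s₂ x (foldᵇ z s₁ s₂ x)

trᵇ : ℕᵇ → ℕᵇ
trᵇ = foldᵇ zero (λ x _ → x) (λ x _ → x)

catᵇ smashᵇ lessᵇ : ℕᵇ → ℕᵇ → ℕᵇ
catᵇ   x = foldᵇ x (λ _ → 1+[2_]) (λ _ → 2[1+_])
smashᵇ x = foldᵇ zero (λ _ → catᵇ x) (λ _ → catᵇ x)
lessᵇ  x = foldᵇ x (λ _ → trᵇ) (λ _ → trᵇ)

mutual
  ⟦_⟧ᶠᵘⁿ : ∀ {n} → Fun n → Vec ℕᵇ n → ℕᵇ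
  ⟦ O ⟧ᶠᵘⁿ     []           = zero
  ⟦ S₁ ⟧ᶠᵘⁿ    (x ∷ [])     = 1+[2 x ]
  ⟦ S₂ ⟧ᶠᵘⁿ    (x ∷ [])     = 2[1+ x ]
  ⟦ TR ⟧ᶠᵘⁿ    (x ∷ [])     = trᵇ x
  ⟦ CAT ⟧ᶠᵘⁿ   (x ∷ y ∷ []) = catᵇ x y
  ⟦ SMASH ⟧ᶠᵘⁿ (x ∷ y ∷ []) = smashᵇ x y
  ⟦ LESS ⟧ᶠᵘⁿ  (x ∷ y ∷ []) = lessᵇ x y
  ⟦ DEF t ⟧ᶠᵘⁿ xs           = ⟦ t ⟧ᵗ xs
  ⟦ REC g h₁ h₂ _ _ _ _ ⟧ᶠᵘⁿ (x ∷ ys) =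
    foldᵇ (⟦ g ⟧ᶠᵘⁿ ys)
          (λ x z → ⟦ h₁ ⟧ᶠᵘⁿ (x ∷ z ∷ ys))
          (λ x z → ⟦ h₂ ⟧ᶠᵘⁿ (x ∷ z ∷ ys)) x

  ⟦_⟧ᵗ : ∀ {n} → Term Fun n → Vec ℕᵇ n → ℕᵇ
  ⟦ var i ⟧ᵗ    xs = lookup xs i
  ⟦ app f ts ⟧ᵗ xs = ⟦ f ⟧ᶠᵘⁿ (⟦ ts ⟧ᵗˢ xs)

  ⟦_⟧ᵗˢ : ∀ {k n} → Vec (Term Fun n) k → Vec ℕᵇ n → Vec ℕᵇ k
  ⟦ [] ⟧ᵗˢ     xs = []
  ⟦ t ∷ ts ⟧ᵗˢ xs = ⟦ t ⟧ᵗ xs ∷ ⟦ ts ⟧ᵗˢ xs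

⟦_⟧ : ∀ {n} → Formula n → Vec ℕᵇ n → Set
⟦ ⊥′ ⟧    xs = ⊥
⟦ s ≐ t ⟧ xs = ⟦ s ⟧ᵗ xs ≡ ⟦ t ⟧ᵗ xs
⟦ A ∧ B ⟧ xs = ⟦ A ⟧ xs × ⟦ B ⟧ xs
⟦ A ∨ B ⟧ xs = ⟦ A ⟧ xs ⊎ ⟦ B ⟧ xs
⟦ A ⇒ B ⟧ xs = ⟦ A ⟧ xs → ⟦ B ⟧ xs
⟦ ∀′ A ⟧  xs = ∀ x → ⟦ A ⟧ (x ∷ xs)
⟦ ∃′ A ⟧  xs = ∃ λ x → ⟦ A ⟧ (x ∷ xs)

------------------------------------------------------------------------
-- Ordinals and their representations

record Ordinal : Set₁ where
  field
    strictTotalOrder : StrictTotalOrder 0ℓ 0ℓ 0ℓ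
  module < = StrictTotalOrder strictTotalOrder
  field
    <-wellFounded : WellFounded <._<_

  order : RawRelation 0ℓ 0ℓ 0ℓ
  order = record { _≈_ = <._≈_ ; _∼_ = <._<_ }

infix 4 _≅_

_≅_ : RawRelation 0ℓ 0ℓ 0ℓ → RawRelation 0ℓ 0ℓ 0ℓ → Set
P ≅ Q = Σ[ f ∈ (P.Carrier → Q.Carrier) ]
        IsOrderIsomorphism P._≈_ Q._≈_ P._∼_ Q._∼_ f
  where
  module P = RawRelation P
  module Q = RawRelation Q

infixl 6 _⊕_
infixl 7 _⊗_

-- The ordered sum: P followed by Q.
_⊕_ : RawRelation 0ℓ 0ℓ 0ℓ → RawRelation 0ℓ 0ℓ 0ℓ → RawRelation 0ℓ 0ℓ 0ℓ
P ⊕ Q = record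
  { _≈_ = ⊎.Pointwise P._≈_ Q._≈_
  ; _∼_ = P._∼_ ⊎-< Q._∼_
  }
  where
  module P = RawRelation P
  module Q = RawRelation Q

-- The ordinal product P · Q: Q copies of P.
_⊗_ : RawRelation 0ℓ 0ℓ 0ℓ → RawRelation 0ℓ 0ℓ 0ℓ → RawRelation 0ℓ 0ℓ 0ℓ
P ⊗ Q = record
  { _≈_ = ×.Pointwise Q._≈_ P._≈_
  ; _∼_ = ×-Lex Q._≈_ Q._∼_ P._∼_
  }
  where
  module P = RawRelation P
  module Q = RawRelation Q

record OrdinalTerms : Set where
  field
    prec    : Formula 2
    prec-qf : QuantifierFree prec

    plus times minus quotient : Term Fun 2
    zero′ one′                : Term Fun 0

  open Order prec public

  infixl 10 _+′_ _-′_
  infixl 11 _·′_ _÷′_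

  𝟘 𝟙 : ∀ {n} → Term Fun n
  𝟘 = zero′ / []
  𝟙 = one′ / []

  _+′_ _·′_ _-′_ _÷′_ : ∀ {n} → Term Fun n → Term Fun n → Term Fun n
  s +′ t = plus / (s ∷ t ∷ [])
  s ·′ t = times / (s ∷ t ∷ [])
  s -′ t = minus / (s ∷ t ∷ [])
  s ÷′ t = quotient / (s ∷ t ∷ [])

  _≺ᵇ_ : ℕᵇ → ℕᵇ → Set
  a ≺ᵇ b = ⟦ prec ⟧ (a ∷ b ∷ [])

  ≺-order : RawRelation 0ℓ 0ℓ 0ℓ
  ≺-order = record { _≈_ = _≡_ {A = ℕᵇ} ; _∼_ = _≺ᵇ_ }

  -- The initial segment below a, whose order type is the ordinal coded by a.
  below : ℕᵇ → RawRelation 0ℓ 0ℓ 0ℓ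
  below a = record
    { Carrier = ∃ (_≺ᵇ a)
    ; _≈_     = _≡_ on proj₁
    ; _∼_     = _≺ᵇ_ on proj₁
    }

private
  x y z : Term Fun 3
  x = var 0F
  y = var 1F
  z = var 2F

-- Every number codes an ordinal below α.
record PVRepresentation (α : Ordinal) : Set where
  field
    ordinalTerms : OrdinalTerms

  open OrdinalTerms ordinalTerms public

  field
    orderType : ≺-order ≅ Ordinal.order α
    plus-sum  : ∀ a b → below (⟦ plus ⟧ᵗ (a ∷ b ∷ [])) ≅ below a ⊕ below b
    times-product : ∀ a b → below (⟦ times ⟧ᵗ (a ∷ b ∷ [])) ≅ below a ⊗ below b

    ≺-irrefl : PV⊢ ¬′ (x ≺ x)
    ≺-trans  : PV⊢ x ≺ y ∧ y ≺ z ⇒ x ≺ z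
    ≺-total  : PV⊢ x ≺ y ∨ x ≐ y ∨ y ≺ x

    𝟘-least   : PV⊢ 𝟘 ≼ x
    𝟘≺𝟙       : PV⊢ 𝟘 {3} ≺ 𝟙
    ≺-discrete : PV⊢ 𝟘 ≺ x ⇒ 𝟙 ≼ x

    -- Ordinal multiplication distributes over sums on the right factor only.
    +-assoc     : PV⊢ (x +′ y) +′ z ≐ x +′ (y +′ z)
    +-identityˡ : PV⊢ 𝟘 +′ x ≐ x
    +-identityʳ : PV⊢ x +′ 𝟘 ≐ x
    ·-assoc     : PV⊢ (x ·′ y) ·′ z ≐ x ·′ (y ·′ z)
    ·-identityˡ : PV⊢ 𝟙 ·′ x ≐ x
    ·-identityʳ : PV⊢ x ·′ 𝟙 ≐ x
    ·-zeroˡ     : PV⊢ 𝟘 ·′ x ≐ 𝟘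
    ·-zeroʳ     : PV⊢ x ·′ 𝟘 ≐ 𝟘
    ·-distribˡ-+ : PV⊢ x ·′ (y +′ z) ≐ x ·′ y +′ x ·′ z

    +-monoˡ-≼ : PV⊢ x ≼ y ⇒ x +′ z ≼ y +′ z
    ·-monoˡ-≼ : PV⊢ x ≼ y ⇒ x ·′ z ≼ y ·′ z
    +-monoʳ-≺ : PV⊢ x ≺ y ⇒ z +′ x ≺ z +′ y
    ·-monoʳ-≺ : PV⊢ ¬′ (z ≐ 𝟘) ∧ x ≺ y ⇒ z ·′ x ≺ z ·′ y

    minus-spec    : PV⊢ y ≼ x ⇒ y +′ (x -′ y) ≐ x
    quotient-spec : PV⊢ ¬′ (y ≐ 𝟘) ⇒
                        y ·′ (x ÷′ y) ≼ x ∧ x ≺ y ·′ ((x ÷′ y) +′ 𝟙)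

------------------------------------------------------------------------
-- α-flows

module _ {α : Ordinal} (rep : PVRepresentation α) where
  open PVRepresentation rep

  -- The free variables x̄ are shared by A, B, the bound β and H, whose
  -- additional variable 0 is its ordinal argument.
  record Flow {n : ℕ} (A B : Formula n) : Set where
    field
      H           : Formula (suc n)
      H-universal : Universal H
      β           : Term Fun n

      start : PV⊢ A ⇒ ∀≺ 𝟙 H
      step  : PV⊢ ∀≺ β (∀≺ (var 0F) (H /ᶠ (wk ↑)) ⇒
                        ∀≺ (var 0F +′ 𝟙) (H /ᶠ (wk ↑)))
      end   : PV⊢ ∀≺ β H ⇒ B

{-# OPTIONS --safe #-}
-- The formula γ ≺ β ⇒ H(γ) is universal and progressive: if it holds
-- below b ≺ β, then H holds below b, hence below b + 1 by the step of
-- the flow, and b ≺ b + 1.  Transfinite induction yields H everywhere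
-- below β, and the end of the flow yields Δ.
module Submission where

open import Defs
open import Data.Fin.Base using (Fin; zero; suc)
open import Data.Fin.Patterns using (0F)
open import Data.Fin.Substitution using (Sub)
open import Data.List.Base using (List; []; _∷_; [_]; map)
open import Data.List.Membership.Propositional using (_∈_)
open import Data.List.Properties using (map-∘; map-cong)
open import Data.List.Relation.Binary.Subset.Propositional.Properties
  using (⊆-refl; map⁺)
open import Data.List.Relation.Unary.All using (All)
open import Data.List.Relation.Unary.Any using (here; there)
open import Data.Nat.Base using (ℕ; suc)
open import Data.Vec.Base as Vec using (Vec; []; _∷_; lookup)
open import Data.Vec.Properties using (lookup-map; lookup∘tabulate)
open import Data.Vec.Relation.Binary.Pointwise.Extensional using (ext; Pointwise-≡⇒≡)
open import Function.Base using (_∘_)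
open import Relation.Binary.PropositionalEquality
  using (_≡_; refl; sym; trans; cong; cong₂; subst; subst₂; module ≡-Reasoning)

open ≡-Reasoning

private
  variable
    k m n o : ℕ
    R : Rule
    A B : Formula n
    Γ Δ : List (Formula n)

-- Substitution in terms

infixl 9 _⊙_

-- `Vec.map` computes on cons, so the head of a composite such as `sub t ⊙ σ` needs no lemma and
-- only tails have to be compared.
_⊙_ : Sub (Term Fun) m n → Sub (Term Fun) n o → Sub (Term Fun) m o
ρ ⊙ σ = Vec.map (_/ σ) ρ

lookup-ext : {xs ys : Vec (Term Fun n) k} → (∀ i → lookup xs i ≡ lookup ys i) → xs ≡ ys
lookup-ext eq = Pointwise-≡⇒≡ (ext eq)

mutual
  /-⊙ : (t : Term Fun m) (ρ : Sub (Term Fun) m n) (σ : Sub (Term Fun) n o) →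
        t / ρ / σ ≡ t / ρ ⊙ σ
  /-⊙ (var i)    ρ σ = sym (lookup-map i (_/ σ) ρ)
  /-⊙ (app f ts) ρ σ = cong (app f) (/*-⊙ ts ρ σ)

  /*-⊙ : (ts : Vec (Term Fun m) k) (ρ : Sub (Term Fun) m n) (σ : Sub (Term Fun) n o) →
         (ts /* ρ) /* σ ≡ ts /* (ρ ⊙ σ)
  /*-⊙ []       ρ σ = refl
  /*-⊙ (t ∷ ts) ρ σ = cong₂ _∷_ (/-⊙ t ρ σ) (/*-⊙ ts ρ σ)

lookup-vars₁ : (i : Fin n) → lookup (vars {Fun} 1) i ≡ var (suc i)
lookup-vars₁ = lookup∘tabulate _

lookup-↑-suc : (ρ : Sub (Term Fun) m n) (i : Fin m) →
               lookup (ρ ↑) (suc i) ≡ lookup ρ i / vars 1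
lookup-↑-suc ρ i = lookup-map i (_/ vars 1) ρ

lookup-id : (i : Fin n) → lookup (id {Fun}) i ≡ var i
lookup-id zero    = refl
lookup-id (suc i) = begin
  lookup (id ↑) (suc i)  ≡⟨ lookup-↑-suc id i ⟩
  lookup id i / vars 1   ≡⟨ cong (_/ vars 1) (lookup-id i) ⟩
  lookup (vars 1) i      ≡⟨ lookup-vars₁ i ⟩
  var (suc i)            ∎

mutual
  /-id : (t : Term Fun n) → t / id ≡ t
  /-id (var i)    = lookup-id i
  /-id (app f ts) = cong (app f) (/*-id ts)

  /*-id : (ts : Vec (Term Fun n) k) → ts /* id ≡ ts
  /*-id []       = refl
  /*-id (t ∷ ts) = cong₂ _∷_ (/-id t) (/*-id ts)

id-⊙ : (σ : Sub (Term Fun) m n) → id ⊙ σ ≡ σ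
id-⊙ σ = lookup-ext λ i →
  trans (lookup-map i (_/ σ) id) (cong (_/ σ) (lookup-id i))

-- `wk` unfolds to `id ⊙ vars 1`. Lifting by `_↑` uses `vars 1`, whereas `weaken` and `∀≺` use `wk`,
-- so the two forms have to be exchanged.
wk≡vars₁ : wk {Fun} {n} ≡ vars 1
wk≡vars₁ = id-⊙ (vars 1)

vars₁-⊙-∷ : (t : Term Fun n) (σ : Sub (Term Fun) m n) → vars 1 ⊙ (t ∷ σ) ≡ σ
vars₁-⊙-∷ t σ = lookup-ext λ i →
  trans (lookup-map i (_/ (t ∷ σ)) (vars 1)) (cong (_/ (t ∷ σ)) (lookup-vars₁ i))

wk-⊙-∷ : (t : Term Fun n) (σ : Sub (Term Fun) m n) → wk ⊙ (t ∷ σ) ≡ σ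
wk-⊙-∷ t σ = trans (cong (_⊙ (t ∷ σ)) wk≡vars₁) (vars₁-⊙-∷ t σ)

-- `σ ↑` is a cons with tail `σ ⊙ vars 1`, and `wk` skips its head.
wk-⊙-↑ : (σ : Sub (Term Fun) m n) → wk ⊙ σ ↑ ≡ σ ⊙ wk
wk-⊙-↑ σ = trans (wk-⊙-∷ _ _) (cong (σ ⊙_) (sym wk≡vars₁))

/-wk-↑ : (t : Term Fun m) (σ : Sub (Term Fun) m n) → t / wk / σ ↑ ≡ t / σ / wk
/-wk-↑ t σ = begin
  t / wk / σ ↑   ≡⟨ /-⊙ t wk (σ ↑) ⟩
  t / wk ⊙ σ ↑   ≡⟨ cong (t /_) (wk-⊙-↑ σ) ⟩
  t / σ ⊙ wk     ≡⟨ /-⊙ t σ wk ⟨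
  t / σ / wk     ∎

/-wk-∷ : (t u : Term Fun n) → t / wk / sub u ≡ t
/-wk-∷ t u = begin
  t / wk / sub u   ≡⟨ /-⊙ t wk (sub u) ⟩
  t / wk ⊙ sub u   ≡⟨ cong (t /_) (wk-⊙-∷ u id) ⟩
  t / id           ≡⟨ /-id t ⟩
  t                ∎

⊙-↑ : (ρ : Sub (Term Fun) m n) (σ : Sub (Term Fun) n o) → ρ ↑ ⊙ σ ↑ ≡ (ρ ⊙ σ) ↑
⊙-↑ ρ σ = lookup-ext λ where
  zero    → refl
  (suc i) → begin
    lookup (ρ ↑ ⊙ σ ↑) (suc i)       ≡⟨ lookup-map (suc i) (_/ σ ↑) (ρ ↑) ⟩
    lookup (ρ ↑) (suc i) / σ ↑       ≡⟨ cong (_/ σ ↑) (lookup-↑-suc ρ i) ⟩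
    lookup ρ i / vars 1 / σ ↑        ≡⟨ cong (λ τ → lookup ρ i / τ / σ ↑) wk≡vars₁ ⟨
    lookup ρ i / wk / σ ↑            ≡⟨ /-wk-↑ (lookup ρ i) σ ⟩
    lookup ρ i / σ / wk              ≡⟨ cong (_/ wk) (lookup-map i (_/ σ) ρ) ⟨
    lookup (ρ ⊙ σ) i / wk            ≡⟨ cong (lookup (ρ ⊙ σ) i /_) wk≡vars₁ ⟩
    lookup (ρ ⊙ σ) i / vars 1        ≡⟨ lookup-↑-suc (ρ ⊙ σ) i ⟨
    lookup ((ρ ⊙ σ) ↑) (suc i)       ∎

-- Substitution in formulas

/ᶠ-⊙ : (A : Formula m) (ρ : Sub (Term Fun) m n) (σ : Sub (Term Fun) n o) →
       A /ᶠ ρ /ᶠ σ ≡ A /ᶠ (ρ ⊙ σ)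
/ᶠ-⊙ ⊥′      ρ σ = refl
/ᶠ-⊙ (s ≐ t) ρ σ = cong₂ _≐_ (/-⊙ s ρ σ) (/-⊙ t ρ σ)
/ᶠ-⊙ (A ∧ B) ρ σ = cong₂ _∧_ (/ᶠ-⊙ A ρ σ) (/ᶠ-⊙ B ρ σ)
/ᶠ-⊙ (A ∨ B) ρ σ = cong₂ _∨_ (/ᶠ-⊙ A ρ σ) (/ᶠ-⊙ B ρ σ)
/ᶠ-⊙ (A ⇒ B) ρ σ = cong₂ _⇒_ (/ᶠ-⊙ A ρ σ) (/ᶠ-⊙ B ρ σ)
/ᶠ-⊙ (∀′ A)  ρ σ = cong ∀′ (trans (/ᶠ-⊙ A (ρ ↑) (σ ↑)) (cong (A /ᶠ_) (⊙-↑ ρ σ)))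
/ᶠ-⊙ (∃′ A)  ρ σ = cong ∃′ (trans (/ᶠ-⊙ A (ρ ↑) (σ ↑)) (cong (A /ᶠ_) (⊙-↑ ρ σ)))

/ᶠ-id : (A : Formula n) → A /ᶠ id ≡ A
/ᶠ-id ⊥′      = refl
/ᶠ-id (s ≐ t) = cong₂ _≐_ (/-id s) (/-id t)
/ᶠ-id (A ∧ B) = cong₂ _∧_ (/ᶠ-id A) (/ᶠ-id B)
/ᶠ-id (A ∨ B) = cong₂ _∨_ (/ᶠ-id A) (/ᶠ-id B)
/ᶠ-id (A ⇒ B) = cong₂ _⇒_ (/ᶠ-id A) (/ᶠ-id B)
-- `id ↑` is by definition `id` on one more variable, so the induction hypothesis applies as it
-- stands.
/ᶠ-id (∀′ A)  = cong ∀′ (/ᶠ-id A)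
/ᶠ-id (∃′ A)  = cong ∃′ (/ᶠ-id A)

-- Both sides instantiate `A` by `t / σ ∷ σ`. This serves the rules that mention `sub`: `∀L`, `∃R`
-- and `≐-subst`.
sub-/ᶠ : (A : Formula (suc m)) (t : Term Fun m) (σ : Sub (Term Fun) m n) →
         A /ᶠ sub t /ᶠ σ ≡ A /ᶠ (σ ↑) /ᶠ sub (t / σ)
sub-/ᶠ A t σ = begin
  A /ᶠ sub t /ᶠ σ             ≡⟨ /ᶠ-⊙ A (sub t) σ ⟩
  A /ᶠ (t / σ ∷ id ⊙ σ)       ≡⟨ cong (λ τ → A /ᶠ (t / σ ∷ τ)) lemma ⟩
  A /ᶠ (σ ↑ ⊙ sub (t / σ))    ≡⟨ /ᶠ-⊙ A (σ ↑) (sub (t / σ)) ⟨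
  A /ᶠ (σ ↑) /ᶠ sub (t / σ)     ∎
  where
  lemma : id ⊙ σ ≡ Vec.map (_/ vars 1) σ ⊙ sub (t / σ)
  lemma = lookup-ext λ i → begin
    lookup (id ⊙ σ) i                                 ≡⟨ cong (λ τ → lookup τ i) (id-⊙ σ) ⟩
    lookup σ i                                        ≡⟨ /-wk-∷ (lookup σ i) (t / σ) ⟨
    lookup σ i / wk / sub (t / σ)                     ≡⟨ cong (λ τ → lookup σ i / τ / sub (t / σ)) wk≡vars₁ ⟩
    lookup σ i / vars 1 / sub (t / σ)                 ≡⟨ cong (_/ sub (t / σ)) (lookup-map i (_/ vars 1) σ) ⟨
    lookup (Vec.map (_/ vars 1) σ) i / sub (t / σ)    ≡⟨ lookup-map i (_/ sub (t / σ)) (Vec.map (_/ vars 1) σ) ⟨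
    lookup (Vec.map (_/ vars 1) σ ⊙ sub (t / σ)) i    ∎

weaken-/ᶠ-↑ : (σ : Sub (Term Fun) m n) (A : Formula m) → weaken A /ᶠ (σ ↑) ≡ weaken (A /ᶠ σ)
weaken-/ᶠ-↑ σ A = begin
  A /ᶠ wk /ᶠ (σ ↑)      ≡⟨ /ᶠ-⊙ A wk (σ ↑) ⟩
  A /ᶠ (wk ⊙ σ ↑)     ≡⟨ cong (A /ᶠ_) (wk-⊙-↑ σ) ⟩
  A /ᶠ (σ ⊙ wk)       ≡⟨ /ᶠ-⊙ A σ wk ⟨
  A /ᶠ σ /ᶠ wk        ∎

-- For the side formulas of `∀R` and `∃L`: a lifted substitution leaves them weakened past the
-- eigenvariable.
map-weaken-/ᶠ-↑ : (σ : Sub (Term Fun) m n) (Γ : List (Formula m)) →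
                  map (_/ᶠ (σ ↑)) (map weaken Γ) ≡ map weaken (map (_/ᶠ σ) Γ)
map-weaken-/ᶠ-↑ σ Γ = begin
  map (_/ᶠ (σ ↑)) (map weaken Γ)   ≡⟨ map-∘ Γ ⟨
  map ((_/ᶠ (σ ↑)) ∘ weaken) Γ     ≡⟨ map-cong (weaken-/ᶠ-↑ σ) Γ ⟩
  map (weaken ∘ (_/ᶠ σ)) Γ       ≡⟨ map-∘ Γ ⟩
  map weaken (map (_/ᶠ σ) Γ)     ∎

-- `wk ↑` makes room for a fresh variable 1 and `sub (var 0F)` closes the gap again. The composite
-- reduces to `var 0F ∷ wk`, which is `id` by definition.
wk↑-sub-0 : (A : Formula (suc n)) → A /ᶠ (wk ↑) /ᶠ sub (var 0F) ≡ A
wk↑-sub-0 A = begin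
  A /ᶠ (wk ↑) /ᶠ sub (var 0F)                             ≡⟨ /ᶠ-⊙ A (wk ↑) (sub (var 0F)) ⟩
  A /ᶠ (var 0F ∷ Vec.map (_/ vars 1) wk ⊙ sub (var 0F)) ≡⟨ cong (λ τ → A /ᶠ (var 0F ∷ τ)) lemma ⟩
  A /ᶠ id                                               ≡⟨ /ᶠ-id A ⟩
  A                                                     ∎
  where
  lemma : Vec.map (_/ vars 1) wk ⊙ sub (var 0F) ≡ wk {Fun}
  lemma = lookup-ext λ i → begin
    lookup (Vec.map (_/ vars 1) wk ⊙ sub (var 0F)) i   ≡⟨ lookup-map i (_/ sub (var 0F)) (Vec.map (_/ vars 1) wk) ⟩
    lookup (Vec.map (_/ vars 1) wk) i / sub (var 0F)   ≡⟨ cong (_/ sub (var 0F)) (lookup-map i (_/ vars 1) wk) ⟩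
    lookup wk i / vars 1 / sub (var 0F)                ≡⟨ cong (λ τ → lookup wk i / τ / sub (var 0F)) wk≡vars₁ ⟨
    lookup wk i / wk / sub (var 0F)                    ≡⟨ /-wk-∷ (lookup wk i) (var 0F) ⟩
    lookup wk i                                        ∎

/ᶠ-quantifierFree : QuantifierFree A → (σ : Sub (Term Fun) m n) → QuantifierFree (A /ᶠ σ)
/ᶠ-quantifierFree ⊥′      σ = ⊥′
/ᶠ-quantifierFree (s ≐ t) σ = (s / σ) ≐ (t / σ)
/ᶠ-quantifierFree (A ∧ B) σ = /ᶠ-quantifierFree A σ ∧ /ᶠ-quantifierFree B σ
/ᶠ-quantifierFree (A ∨ B) σ = /ᶠ-quantifierFree A σ ∨ /ᶠ-quantifierFree B σ
/ᶠ-quantifierFree (A ⇒ B) σ = /ᶠ-quantifierFree A σ ⇒ /ᶠ-quantifierFree B σ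

/ᶠ-universal : Universal A → (σ : Sub (Term Fun) m n) → Universal (A /ᶠ σ)
/ᶠ-universal (open′ A) σ = open′ (/ᶠ-quantifierFree A σ)
/ᶠ-universal (A ∧ B)   σ = /ᶠ-universal A σ ∧ /ᶠ-universal B σ
/ᶠ-universal (A ∨ B)   σ = /ᶠ-universal A σ ∨ /ᶠ-universal B σ
/ᶠ-universal (A ⇒ B)   σ = /ᶠ-quantifierFree A σ ⇒ /ᶠ-universal B σ
/ᶠ-universal (∀′ A)    σ = ∀′ (/ᶠ-universal A (σ ↑))

-- Derivations

pvAxiom-/ᶠ : PVAxiom A → (σ : Sub (Term Fun) m n) → PVAxiom (A /ᶠ σ)
pvAxiom-/ᶠ (equation e) σ = equation (≈-subst e σ)
pvAxiom-/ᶠ (S₁≢O t)     σ = S₁≢O (t / σ)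
pvAxiom-/ᶠ (S₂≢O t)     σ = S₂≢O (t / σ)
pvAxiom-/ᶠ (cases t)    σ = cases (t / σ)

-- Carries PV theorems, stated in fixed variables, to arbitrary terms and under eigenvariables.
-- `noRule` is empty, so there is no case for `rule`.
⊢-/ᶠ : {Γ Δ : List (Formula m)} → noRule ⊢ Γ ⟹ Δ → (σ : Sub (Term Fun) m n) →
       noRule ⊢ map (_/ᶠ σ) Γ ⟹ map (_/ᶠ σ) Δ
⊢-/ᶠ (ax A)             σ = ax (A /ᶠ σ)
⊢-/ᶠ (structural p q d) σ = structural (map⁺ _ p) (map⁺ _ q) (⊢-/ᶠ d σ)
⊢-/ᶠ (cut A d e)        σ = cut (A /ᶠ σ) (⊢-/ᶠ d σ) (⊢-/ᶠ e σ)
⊢-/ᶠ ⊥L                 σ = ⊥L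
⊢-/ᶠ (∧L d)             σ = ∧L (⊢-/ᶠ d σ)
⊢-/ᶠ (∧R d e)           σ = ∧R (⊢-/ᶠ d σ) (⊢-/ᶠ e σ)
⊢-/ᶠ (∨L d e)           σ = ∨L (⊢-/ᶠ d σ) (⊢-/ᶠ e σ)
⊢-/ᶠ (∨R d)             σ = ∨R (⊢-/ᶠ d σ)
⊢-/ᶠ (⇒L d e)           σ = ⇒L (⊢-/ᶠ d σ) (⊢-/ᶠ e σ)
⊢-/ᶠ (⇒R d)             σ = ⇒R (⊢-/ᶠ d σ)
⊢-/ᶠ (∀L {Γ = Γ} {Δ} {A} t d) σ =
  ∀L (t / σ) (subst (λ B → noRule ⊢ B ∷ map (_/ᶠ σ) Γ ⟹ map (_/ᶠ σ) Δ)
                    (sub-/ᶠ A t σ) (⊢-/ᶠ d σ))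
⊢-/ᶠ (∀R {Γ = Γ} {Δ} {A} d) σ =
  ∀R (subst₂ (λ Γ′ Δ′ → noRule ⊢ Γ′ ⟹ A /ᶠ (σ ↑) ∷ Δ′)
             (map-weaken-/ᶠ-↑ σ Γ) (map-weaken-/ᶠ-↑ σ Δ) (⊢-/ᶠ d (σ ↑)))
⊢-/ᶠ (∃L {Γ = Γ} {Δ} {A} d) σ =
  ∃L (subst₂ (λ Γ′ Δ′ → noRule ⊢ A /ᶠ (σ ↑) ∷ Γ′ ⟹ Δ′)
             (map-weaken-/ᶠ-↑ σ Γ) (map-weaken-/ᶠ-↑ σ Δ) (⊢-/ᶠ d (σ ↑)))
⊢-/ᶠ (∃R {Γ = Γ} {Δ} {A} t d) σ =
  ∃R (t / σ) (subst (λ B → noRule ⊢ map (_/ᶠ σ) Γ ⟹ B ∷ map (_/ᶠ σ) Δ)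
                    (sub-/ᶠ A t σ) (⊢-/ᶠ d σ))
⊢-/ᶠ (≐-refl t)         σ = ≐-refl (t / σ)
⊢-/ᶠ (≐-subst A s t)    σ =
  subst₂ (λ B C → noRule ⊢ (s / σ) ≐ (t / σ) ∷ B ∷ [] ⟹ [ C ])
         (sym (sub-/ᶠ A s σ)) (sym (sub-/ᶠ A t σ))
         (≐-subst (A /ᶠ (σ ↑)) (s / σ) (t / σ))
⊢-/ᶠ (pv a)             σ = pv (pvAxiom-/ᶠ a σ)

noRule-⊢ : noRule ⊢ Γ ⟹ Δ → R ⊢ Γ ⟹ Δ
noRule-⊢ (ax A)             = ax A
noRule-⊢ (structural p q d) = structural p q (noRule-⊢ d)
noRule-⊢ (cut A d e)        = cut A (noRule-⊢ d) (noRule-⊢ e)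
noRule-⊢ ⊥L                 = ⊥L
noRule-⊢ (∧L d)             = ∧L (noRule-⊢ d)
noRule-⊢ (∧R d e)           = ∧R (noRule-⊢ d) (noRule-⊢ e)
noRule-⊢ (∨L d e)           = ∨L (noRule-⊢ d) (noRule-⊢ e)
noRule-⊢ (∨R d)             = ∨R (noRule-⊢ d)
noRule-⊢ (⇒L d e)           = ⇒L (noRule-⊢ d) (noRule-⊢ e)
noRule-⊢ (⇒R d)             = ⇒R (noRule-⊢ d)
noRule-⊢ (∀L t d)           = ∀L t (noRule-⊢ d)
noRule-⊢ (∀R d)             = ∀R (noRule-⊢ d)
noRule-⊢ (∃L d)             = ∃L (noRule-⊢ d)
noRule-⊢ (∃R t d)           = ∃R t (noRule-⊢ d)
noRule-⊢ (≐-refl t)         = ≐-refl t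
noRule-⊢ (≐-subst A s t)    = ≐-subst A s t
noRule-⊢ (pv a)             = pv a

-- Derived rules in natural-deduction style, with a single succedent

⊢-cast : A ≡ B → R ⊢ Γ ⟹ [ A ] → R ⊢ Γ ⟹ [ B ]
⊢-cast refl d = d

hyp : A ∈ Γ → R ⊢ Γ ⟹ [ A ]
hyp {A = A} i = structural (λ { (here refl) → i }) ⊆-refl (ax A)

thm : R ⊢ [] ⟹ [ A ] → R ⊢ Γ ⟹ [ A ]
thm = structural (λ ()) ⊆-refl

cutᵢ : R ⊢ Γ ⟹ [ A ] → R ⊢ A ∷ Γ ⟹ Δ → R ⊢ Γ ⟹ Δ
cutᵢ {A = A} d = cut A (structural ⊆-refl (λ { (here refl) → here refl }) d)

⇒E : R ⊢ Γ ⟹ [ A ⇒ B ] → R ⊢ Γ ⟹ [ A ] → R ⊢ Γ ⟹ [ B ]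
⇒E d e = cutᵢ d (⇒L (structural ⊆-refl (λ { (here refl) → here refl }) e) (hyp (here refl)))

∀E : (t : Term Fun n) {A : Formula (suc n)} → R ⊢ Γ ⟹ [ ∀′ A ] → R ⊢ Γ ⟹ [ A /ᶠ sub t ]
∀E t d = cutᵢ d (∀L t (hyp (here refl)))

-- Uses a universal statement from outside the scope of an eigenvariable at that eigenvariable.
∀′-weaken-open : {A : Formula (suc n)} {Γ : List (Formula (suc n))} →
                 R ⊢ Γ ⟹ [ weaken (∀′ A) ] → R ⊢ Γ ⟹ [ A ]
∀′-weaken-open {A = A} d = ⊢-cast (wk↑-sub-0 A) (∀E (var 0F) d)

≐E : (A : Formula (suc n)) {s t : Term Fun n} →
     R ⊢ Γ ⟹ [ s ≐ t ] → R ⊢ Γ ⟹ [ A /ᶠ sub s ] → R ⊢ Γ ⟹ [ A /ᶠ sub t ]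
≐E A {s} {t} d e =
  cutᵢ e (cutᵢ (structural there ⊆-refl d)
    (structural (λ { (here refl) → here refl ; (there (here refl)) → there (here refl) })
                ⊆-refl (≐-subst A s t)))

⋁E : (Δ : List (Formula n)) → R ⊢ [ ⋁ Δ ] ⟹ Δ
⋁E []      = ⊥L
⋁E (A ∷ Δ) = ∨L (structural ⊆-refl (λ { (here refl) → here refl }) (ax A))
               (structural ⊆-refl there (⋁E Δ))

-- Progressive formulas and flows

module _ (prec : Formula 2) where
  open Order prec

  ≺-/ᶠ : (s t : Term Fun m) (σ : Sub (Term Fun) m n) → (s ≺ t) /ᶠ σ ≡ (s / σ) ≺ (t / σ)
  ≺-/ᶠ s t σ = /ᶠ-⊙ prec (s ∷ t ∷ []) σ

  ∀≺-/ᶠ : (t : Term Fun m) (A : Formula (suc m)) (σ : Sub (Term Fun) m n) →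
          ∀≺ t A /ᶠ σ ≡ ∀≺ (t / σ) (A /ᶠ (σ ↑))
  ∀≺-/ᶠ t A σ = cong (λ B → ∀′ (B ⇒ (A /ᶠ (σ ↑))))
    (trans (≺-/ᶠ (var 0F) (t / wk) (σ ↑)) (cong (var 0F ≺_) (/-wk-↑ t σ)))

  -- The premise of `induction` without side formulas. It is derived in PV alone, so that `⊢-/ᶠ` can
  -- rename it.
  Progressive : Formula (suc n) → Set
  Progressive A = noRule ⊢ [ ∀≺ (var 0F) (A /ᶠ (wk ↑)) ] ⟹ [ A ]

  -- The rule concludes A(δ) for a single term δ; taking δ to be a variable
  -- allows generalising it, hence the renaming of A by wk ↑.
  TI-progressive : {A : Formula (suc n)} → Universal A → Progressive A →
                   TI Universal prec ⊢ [] ⟹ [ ∀′ A ]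
  TI-progressive {n = n} {A = A} u p =
    ∀R (⊢-cast (wk↑-sub-0 A)
         (rule (induction (/ᶠ-universal u (wk ↑)) (var 0F)) (noRule-⊢ premise)))
    where
    -- Here variable 0 is the eigenvariable of the induction and variable 1 the one generalised by
    -- `∀R`.
    premise : noRule ⊢ [ ∀≺ (var 0F) (A /ᶠ (wk ↑) /ᶠ (wk ↑)) ] ⟹ [ A /ᶠ (wk ↑) ]
    premise = subst (λ B → noRule ⊢ [ B ] ⟹ [ A /ᶠ (wk ↑) ]) eq (⊢-/ᶠ p (wk ↑))
      where
      -- The second renamings differ only at variable 1, which the first one has made absent. Both
      -- composites fix 0 and shift the other variables by two.
      swap : A /ᶠ (wk ↑) /ᶠ ((wk ↑) ↑) ≡ A /ᶠ (wk ↑) /ᶠ (wk ↑)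
      swap = begin
        A /ᶠ (wk ↑) /ᶠ ((wk ↑) ↑)   ≡⟨ /ᶠ-⊙ A (wk ↑) ((wk ↑) ↑) ⟩
        A /ᶠ (wk ↑ ⊙ (wk ↑) ↑)      ≡⟨ cong (A /ᶠ_) (⊙-↑ wk (wk ↑)) ⟩
        A /ᶠ ((wk ⊙ wk ↑) ↑)        ≡⟨ cong (λ ρ → A /ᶠ (ρ ↑)) (wk-⊙-↑ wk) ⟩
        A /ᶠ ((wk ⊙ wk) ↑)          ≡⟨ cong (A /ᶠ_) (⊙-↑ wk wk) ⟨
        A /ᶠ (wk ↑ ⊙ wk ↑)          ≡⟨ /ᶠ-⊙ A (wk ↑) (wk ↑) ⟨
        A /ᶠ (wk ↑) /ᶠ (wk ↑)       ∎

      eq : ∀≺ (var 0F) (A /ᶠ (wk ↑)) /ᶠ (wk ↑) ≡ ∀≺ (var 0F) (A /ᶠ (wk ↑) /ᶠ (wk ↑))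
      eq = trans (∀≺-/ᶠ (var 0F) (A /ᶠ (wk ↑)) (wk ↑)) (cong (∀≺ (var 0F)) swap)

-- Ordinal arithmetic in PV and the progressivity of flows

module _ {α : Ordinal} (rep : PVRepresentation α) where
  open PVRepresentation rep

  private
    variable
      s t u : Term Fun n

  pv-instance : {A : Formula 3} → PV⊢ A → (σ : Sub (Term Fun) 3 n) → R ⊢ Γ ⟹ [ A /ᶠ σ ]
  pv-instance d σ = thm (noRule-⊢ (⊢-/ᶠ d σ))

  𝟙-/ : (σ : Sub (Term Fun) m n) → 𝟙 / σ ≡ 𝟙
  𝟙-/ σ = /-⊙ one′ [] σ

  ≺-transitive : R ⊢ Γ ⟹ [ s ≺ t ] → R ⊢ Γ ⟹ [ t ≺ u ] → R ⊢ Γ ⟹ [ s ≺ u ]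
  ≺-transitive {s = s} {t} {u} d e =
    ⇒E (⊢-cast (cong₂ _⇒_ (cong₂ _∧_ (≺-/ᶠ prec _ _ σ) (≺-/ᶠ prec _ _ σ)) (≺-/ᶠ prec _ _ σ))
               (pv-instance ≺-trans σ))
       (∧R d e)
    where σ = s ∷ t ∷ u ∷ []

  -- Adding `t` on the left of `𝟘 ≺ 𝟙` gives `t +′ 𝟘 ≺ t +′ 𝟙`, and `t +′ 𝟘` equals `t`.
  t≺t+𝟙 : (t : Term Fun n) → R ⊢ Γ ⟹ [ t ≺ t +′ 𝟙 ]
  t≺t+𝟙 {n = n} {R = R} {Γ = Γ} t =
    ⊢-cast (at t) (≐E (var 0F ≺ ((t +′ 𝟙) / wk)) t+𝟘≐t (⊢-cast (sym (at (t +′ 𝟘))) t+𝟘≺t+𝟙))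
    where
    -- `+-monoʳ-≺` compares its first two variables and adds the third on their left.
    σ : Sub (Term Fun) 3 n
    σ = 𝟘 ∷ 𝟙 ∷ t ∷ []

    -- Weakening the right-hand side shields it, so that `≐E` rewrites only the term to the left of
    -- `≺`.
    at : (s : Term Fun n) → (var 0F ≺ ((t +′ 𝟙) / wk)) /ᶠ sub s ≡ s ≺ t +′ 𝟙
    at s = trans (≺-/ᶠ prec _ _ (sub s)) (cong (s ≺_) (/-wk-∷ (t +′ 𝟙) s))

    t+𝟘≐t : R ⊢ Γ ⟹ [ t +′ 𝟘 ≐ t ]
    t+𝟘≐t = ⊢-cast
      (cong (_≐ t) (trans (/-⊙ plus _ τ) (cong (λ z → t +′ z) (/-⊙ zero′ [] τ))))
      (pv-instance +-identityʳ τ)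
      -- The first entry instantiates `+-identityʳ`; the others fill up the three variables in which
      -- the ordinal axioms are stated.
      where τ = t ∷ t ∷ t ∷ []

    𝟘≺𝟙ₙ : R ⊢ Γ ⟹ [ 𝟘 ≺ 𝟙 ]
    𝟘≺𝟙ₙ = ⊢-cast (trans (≺-/ᶠ prec _ _ σ) (cong₂ _≺_ (/-⊙ zero′ [] σ) (𝟙-/ σ)))
                  (pv-instance 𝟘≺𝟙 σ)

    t+𝟘≺t+𝟙 : R ⊢ Γ ⟹ [ t +′ 𝟘 ≺ t +′ 𝟙 ]
    t+𝟘≺t+𝟙 = ⇒E
      (⊢-cast (cong₂ _⇒_ (≺-/ᶠ prec _ _ σ)
                         (trans (≺-/ᶠ prec _ _ σ) (cong₂ _≺_ (/-⊙ plus _ σ) (/-⊙ plus _ σ))))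
              (pv-instance +-monoʳ-≺ σ))
      𝟘≺𝟙ₙ

  -- The flow grants its step only below `β`. The guard supplies that bound at the eigenvariable,
  -- and at ordinals not below `β` the formula holds vacuously.
  flow-progressive : {A B : Formula n} (F : Flow rep A B) →
                     let open Flow F in Progressive prec (var 0F ≺ (β / wk) ⇒ H)
  flow-progressive {n = n} F = ⇒R (∀≺-succ (⇒E (⇒E step′ (hyp (here refl))) belowH))
    where
    open Flow F

    b≺β : Formula (suc n)
    b≺β = var 0F ≺ (β / wk)

    -- The body of the hypothesis on all γ below b, named so that it can be handed to
    -- `∀′-weaken-open`.
    IHᵧ : Formula (suc (suc n))
    IHᵧ = var 0F ≺ (var 0F / wk) ⇒ (b≺β ⇒ H) /ᶠ (wk ↑)

    IH : Formula (suc n)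
    IH = ∀′ IHᵧ

    step′ : {Γ : List (Formula (suc n))} →
            noRule ⊢ Γ ⟹ [ b≺β ⇒ ∀≺ (var 0F) (H /ᶠ (wk ↑)) ⇒ ∀≺ (var 0F +′ 𝟙) (H /ᶠ (wk ↑)) ]
    step′ = thm (∀′-weaken-open (noRule-⊢ (⊢-/ᶠ step wk)))

    belowH : noRule ⊢ b≺β ∷ IH ∷ [] ⟹ [ ∀≺ (var 0F) (H /ᶠ (wk ↑)) ]
    belowH = ∀R (⇒R (⇒E
      (⇒E (∀′-weaken-open {A = IHᵧ} (hyp (there (there (here refl))))) (hyp (here refl)))
      γ≺β))
      where
      -- The induction hypothesis at γ is itself guarded; γ ≺ b ≺ β discharges the guard.
      γ≺β : noRule ⊢ var 0F ≺ (var 0F / wk) ∷ map weaken (b≺β ∷ IH ∷ []) ⟹ [ b≺β /ᶠ (wk ↑) ]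
      γ≺β = ⊢-cast
        (sym (trans (≺-/ᶠ prec _ _ (wk ↑)) (cong (var 0F ≺_) (/-wk-↑ β wk))))
        (≺-transitive (hyp (here refl))
          (⊢-cast (≺-/ᶠ prec _ _ wk) (hyp (there (here refl)))))

    ∀≺-succ : {Γ : List (Formula (suc n))} →
              noRule ⊢ Γ ⟹ [ ∀≺ (var 0F +′ 𝟙) (H /ᶠ (wk ↑)) ] → noRule ⊢ Γ ⟹ [ H ]
    -- The instance at b itself, which lies below b + 1 by `t≺t+𝟙`.
    ∀≺-succ d = ⊢-cast (wk↑-sub-0 H) (⇒E (∀E (var 0F) d)
      (⊢-cast (sym (trans (≺-/ᶠ prec _ _ (sub (var 0F)))
                          (cong (var 0F ≺_) (/-wk-∷ (var 0F +′ 𝟙) (var 0F)))))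
              (t≺t+𝟙 (var 0F))))

theorem4p9 : ∀ {α : Ordinal} (rep : PVRepresentation α) {n} (Γ Δ : List (Formula n)) →
    All Universal Γ → All Universal Δ →
    Flow rep (⋀ Γ) (⋁ Δ) →
    TI Universal (PVRepresentation.prec rep) ⊢ Γ ⟹ Δ
theorem4p9 rep Γ Δ _ _ F =
  -- The flow's `end` yields the single formula `⋁ Δ`, which a last cut breaks up into the list `Δ`.
  cutᵢ (thm (⇒E (noRule-⊢ end) ∀≺βH))
       (structural (λ { (here refl) → here refl }) ⊆-refl (⋁E Δ))
  where
  open PVRepresentation rep
  open Flow F

  ∀≺βH : TI Universal prec ⊢ [] ⟹ [ ∀≺ β H ]
  -- The guard is quantifier-free because `prec` is, so it may stand before ⇒ in a universal
  -- formula. Generalising the guarded formula gives `∀≺ β H` by definition.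
  ∀≺βH = TI-progressive prec (/ᶠ-quantifierFree prec-qf _ ⇒ H-universal)
                             (flow-progressive rep F)
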